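{- Let $G$ be a finite connected graph with an oriented partition, universal group $\Gamma_{\mathrm{univ}}$ with free part $\mathbb{Z}^f$, class generators $g_j\in\Gamma_{\mathrm{univ}}$ and universal labeling $\phi\colon V(G)\to\Gamma_{\mathrm{univ}}$. Let $R_i$ be the range of free coordinate $i$ over the vertex labels, i.e. $R_i=\max_v\phi(v)_i-\min_v\phi(v)_i$, and let $\gamma_i=\max_j|(g_j)_i|$. The diagonal fold $L=N_1\mathbb{Z}\times\cdots\times N_f\mathbb{Z}$ is isometric whenever $N_i>R_i+\mathrm{diam}(G)\,\gamma_i$ for every $i$.
   Context: An oriented partition of $G$ is a partition $\{F_1,\dots,F_t\}$ of $E(G)$ together with a chosen (forward) direction for each edge. Its signed cycle–class matrix $A\in\mathbb{Z}^{c\times t}$, $c=|E(G)|-|V(G)|+1$, with respect to a cycle basis $B_1,\dots,B_c$ of $G$ (cycles whose edge sets form a basis over $\mathbb{F}_2$ of the cycle space, each traversed in a fixed rotational sense), has $A[i,j]$ equal to the net signed number of crossings of $F_j$ by $B_i$ (forward $+1$, backward $-1$). The universal group is $\Gamma_{\mathrm{univ}}=\mathbb{Z}^t/\mathrm{rowlattice}(A)$, where $\mathrm{rowlattice}(A)$ is the lattice generated by the rows of $A$; $g_j$ is the image of the $j$-th standard basis vector; and the universal labeling is $\phi(v)=\sum_{e\in P(r,v)}\pm g_{\mathrm{class}(e)}$ along a path $P(r,v)$ from a fixed root $r$ to $v$ (sign $+$ for forward traversal, $-$ for backward), where $\mathrm{class}(e)=j$ if $e\in F_j$. The Smith normal form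 of $A^\top$ identifies $\Gamma_{\mathrm{univ}}$ with $T\times\mathbb{Z}^f$, $T$ a finite torsion group, and $x_i$ denotes the $i$-th coordinate of $x$ in the free part $\mathbb{Z}^f$. For a finite-index sublattice $L\subseteq\mathbb{Z}^f$, the fold by $L$ is the finite quotient group $\Gamma_L=\Gamma_{\mathrm{univ}}/L$ (obtained by appending the rows of $L$, pulled back to class coordinates, to $A$) with the labeling induced by $\phi$ and the connection set consisting of the nonzero images of the $\pm g_j$. The fold is isometric if the Cayley-graph distance in $\Gamma_L$ between the labels of $u$ and $v$ equals $d_G(u,v)$ for all vertices $u,v$. The fold is diagonal if $L=N_1\mathbb{Z}\times\cdots\times N_f\mathbb{Z}$ with positive integers $N_i$. The Cayley graph of an abelian group $\Gamma$ with connection set $S=-S\subseteq\Gamma\setminus\{0\}$ has vertex set $\Gamma$ and edges $\{h,h+s\}$, $s\in S$; $d_G$ is the shortest-path metric and $\mathrm{diam}(G)$ the diameter of $G$.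
   Formalization: The formal theorem adds the hypothesis that the universal labeling is itself isometric into the Cayley graph of the universal group; without it the claim fails (path a-b-c, one class, both edges directed to b), and under the stated bound it is necessary. -}

module Defs where

open import Algebra.Bundles using (AbelianGroup; CommutativeRing)
import Algebra.Properties.CommutativeMonoid.Sum as CommutativeMonoidSum
import Algebra.Properties.Semiring.Sum as SemiringSum
open import Data.Bool.Base using (Bool; false; _∧_; _∨_; if_then_else_)
open import Data.Bool.Properties using (xor-∧-commutativeRing)
open import Data.Fin.Base as Fin using (Fin; toℕ; cast; inject≤; _↑ˡ_; _↑ʳ_)
open import Data.Fin.Properties using () renaming (_≟_ to _≟ᶠ_)
open import Data.Integer.Base as ℤ using (ℤ; +_; _◃_; ∣_∣; 0ℤ; 1ℤ)
import Data.Integer.Properties as ℤₚ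
open import Data.Integer.Tactic.RingSolver using (solve-∀)
import Data.List.Extrema as Extrema
import Data.List.Extrema.Nat as ExtremaNat
open import Data.List.Base as List using (List; []; _∷_; _∷ʳ_)
open import Data.List.Membership.DecPropositional using (_∈?_)
open import Data.List.Relation.Unary.Unique.Propositional using (Unique)
open import Data.Nat.Base as ℕ using (ℕ; zero; suc; _≤_; _∸_)
open import Data.Nat.Divisibility using (_∣_)
open import Data.Product.Base using (∃; _×_; _,_; proj₁)
open import Data.Sign.Base as Sign using (Sign)
open import Data.Sum.Base using (_⊎_)
open import Data.Vec.Functional using (Vector; _++_)
open import Function.Definitions using (StrictlySurjective)
open import Level using (0ℓ)
open import Relation.Binary.Core using (Rel)
open import Relation.Binary.PropositionalEquality
  using (_≡_; _≢_; refl; sym; trans; cong; cong₂; module ≡-Reasoning)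
open import Relation.Nullary using (¬_; does)
open import Relation.Unary using (Pred)

open SemiringSum ℤₚ.+-*-semiring public
  using () renaming (sum to sumℤ)

------------------------------------------------------------------------
-- Walks and distances

-- Vertices are compared by a relation _≈_ so that the same notion serves
-- finite graphs (_≈_ is _≡_) and Cayley graphs of quotient groups.

data Walk {V : Set} (_≈_ _∼_ : Rel V 0ℓ) : ℕ → V → V → Set where
  stop : ∀ {u v} → u ≈ v → Walk _≈_ _∼_ zero u v
  step : ∀ {k u w v} → u ∼ w → Walk _≈_ _∼_ k w v → Walk _≈_ _∼_ (suc k) u v

IsDistance : {V : Set} (_≈_ _∼_ : Rel V 0ℓ) → V → V → ℕ → Set
IsDistance _≈_ _∼_ u v k =
  Walk _≈_ _∼_ k u v × (∀ l → Walk _≈_ _∼_ l u v → k ≤ l)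

------------------------------------------------------------------------
-- Finite simple graphs

-- An edge is listed by its endpoints in increasing order, which excludes
-- loops; end-injective excludes multiple edges.

record Graph : Set where
  field
    order size    : ℕ
    end₁ end₂     : Fin size → Fin order
    end-<         : ∀ e → end₁ e Fin.< end₂ e
    end-injective : ∀ e e′ → end₁ e ≡ end₁ e′ → end₂ e ≡ end₂ e′ → e ≡ e′

  Vertex Edge : Set
  Vertex = Fin order
  Edge   = Fin size

  -- A traversal of an edge, with sign + from end₁ to end₂ and sign - from
  -- end₂ to end₁.
  Dart : Set
  Dart = Edge × Sign

  edge : Dart → Edge
  edge = proj₁

  source target : Dart → Vertex
  source (e , Sign.+) = end₁ e
  source (e , Sign.-) = end₂ e
  target (e , Sign.+) = end₂ e
  target (e , Sign.-) = end₁ e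

  Adjacent : Rel Vertex 0ℓ
  Adjacent u v = ∃ λ (d : Dart) → source d ≡ u × target d ≡ v

  GraphWalk : ℕ → Vertex → Vertex → Set
  GraphWalk = Walk _≡_ Adjacent

  GraphDistance : Vertex → Vertex → ℕ → Set
  GraphDistance = IsDistance _≡_ Adjacent

  Connected : Set
  Connected = ∀ u v → ∃ λ k → GraphWalk k u v

  IsDiameter : ℕ → Set
  IsDiameter D =
    (∃ λ u → ∃ λ v → GraphDistance u v D) ×
    (∀ u v k → GraphDistance u v k → k ≤ D)

  darts : ∀ {k u v} → GraphWalk k u v → List Dart
  darts (stop _)         = []
  darts (step (d , _) w) = d ∷ darts w

  sources : ∀ {k u v} → GraphWalk k u v → List Vertex
  sources w = List.map source (darts w)

  record Path (u v : Vertex) : Set where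
    field
      {length} : ℕ
      walk     : GraphWalk length u v
      distinct : Unique (sources walk ∷ʳ v)

  record Cycle : Set where
    field
      {length} : ℕ
      base     : Vertex
      walk     : GraphWalk length base base
      3≤length : 3 ≤ length
      distinct : Unique (sources walk)

  edgeSet : Cycle → Vector Bool size
  edgeSet C e = does (_∈?_ _≟ᶠ_ e (List.map edge (darts (Cycle.walk C))))

  -- Finite sums over 𝔽₂: addition is _xor_ and multiplication is _∧_.
  open CommutativeMonoidSum
    (CommutativeRing.+-commutativeMonoid xor-∧-commutativeRing)
    public using () renaming (sum to sum𝔽₂)

  incident : Edge → Vertex → Bool
  incident e v = does (end₁ e ≟ᶠ v) ∨ does (end₂ e ≟ᶠ v)

  -- The edge sets meeting every vertex in an even number of edges.
  InCycleSpace : Pred (Vector Bool size) 0ℓ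
  InCycleSpace x = ∀ v → sum𝔽₂ (λ e → x e ∧ incident e v) ≡ false

  -- |E| - |V| + 1; the truncated subtraction is exact for connected graphs.
  cycleRank : ℕ
  cycleRank = suc size ∸ order

  record CycleBasis : Set where
    field
      cycle : Fin cycleRank → Cycle

    combination : Vector Bool cycleRank → Vector Bool size
    combination a e = sum𝔽₂ (λ i → a i ∧ edgeSet (cycle i) e)

    field
      independent : ∀ a → (∀ e → combination a e ≡ false) → ∀ i → a i ≡ false
      spanning    : ∀ x → InCycleSpace x → ∃ λ a → ∀ e → x e ≡ combination a e

------------------------------------------------------------------------
-- Integer matrices and Smith normal form

Matrix : ℕ → ℕ → Set
Matrix p q = Vector (Vector ℤ q) p

infixl 7 _⊗_
infix  8 _ᵀ

_⊗_ : ∀ {p q r} → Matrix p q → Matrix q r → Matrix p r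
(M ⊗ N) i k = sumℤ (λ j → M i j ℤ.* N j k)

_ᵀ : ∀ {p q} → Matrix p q → Matrix q p
(M ᵀ) i j = M j i

diagonal : ∀ {p} → Vector ℤ p → Matrix p p
diagonal d i j = if does (i ≟ᶠ j) then d i else 0ℤ

identity : ∀ {p} → Matrix p p
identity = diagonal (λ _ → 1ℤ)

_≗ᴹ_ : ∀ {p q} → Rel (Matrix p q) 0ℓ
M ≗ᴹ N = ∀ i j → M i j ≡ N i j

-- Unimodular U and V such that U ⊗ M ⊗ V has the positive entries
-- factor 0 ∣ factor 1 ∣ ⋯ ∣ factor (rank - 1) at the start of its diagonal
-- and zeros elsewhere.

record SmithNormalForm {p q} (M : Matrix p q) : Set where
  field
    U U⁻¹     : Matrix p p
    V V⁻¹     : Matrix q q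
    U-inverse : (U ⊗ U⁻¹) ≗ᴹ identity × (U⁻¹ ⊗ U) ≗ᴹ identity
    V-inverse : (V ⊗ V⁻¹) ≗ᴹ identity × (V⁻¹ ⊗ V) ≗ᴹ identity

    rank free : ℕ
    rank+free : rank ℕ.+ free ≡ p
    rank≤q    : rank ≤ q

    factor       : Vector ℕ rank
    factor-pos   : ∀ i → 1 ≤ factor i
    factor-chain : ∀ i j → i Fin.≤ j → factor i ∣ factor j

  torsionRow : Fin rank → Fin p
  torsionRow i = cast rank+free (i ↑ˡ free)

  freeRow : Fin free → Fin p
  freeRow i = cast rank+free (rank ↑ʳ i)

  field
    on-diagonal  : ∀ i → (U ⊗ M ⊗ V) (torsionRow i) (inject≤ i rank≤q) ≡ + factor i
    off-diagonal : ∀ i j → toℕ i ≢ toℕ j → (U ⊗ M ⊗ V) i j ≡ 0ℤ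
    zero-rows    : ∀ i j → (U ⊗ M ⊗ V) (freeRow i) j ≡ 0ℤ

  -- x ↦ U x induces ℤᵖ / (column lattice of M) ≅ T × ℤᶠ with
  -- T = ∏ ℤ / factor i, the coordinates in ℤᶠ being the last ones.
  freeCoordinate : Fin free → Vector ℤ p → ℤ
  freeCoordinate i x = sumℤ (λ j → U (freeRow i) j ℤ.* x j)

  -- Rows y ∈ ℤᶠ, sent to U⁻¹ (0 , y).
  pullback : ∀ {l} → Matrix l free → Matrix l p
  pullback L k j = sumℤ (λ i → U⁻¹ j (freeRow i) ℤ.* L k i)

------------------------------------------------------------------------
-- The quotient of ℤᵗ by the lattice generated by the rows of a matrix

module _ {m t : ℕ} (M : Matrix m t) where
  private
    open SemiringSum ℤₚ.+-*-semiring
      using (sum-cong-≗; ∑-distrib-+; *-distribˡ-sum; sum-replicate-zero)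
    open ≡-Reasoning

    combine : Vector ℤ m → Vector ℤ t
    combine a j = sumℤ (λ i → a i ℤ.* M i j)

    combine-0 : ∀ j → combine (λ _ → 0ℤ) j ≡ 0ℤ
    combine-0 j =
      trans (sum-cong-≗ {m} (λ i → ℤₚ.*-zeroˡ (M i j))) (sum-replicate-zero m)

    combine-+ : ∀ a b j →
                combine (λ i → a i ℤ.+ b i) j ≡ combine a j ℤ.+ combine b j
    combine-+ a b j =
      trans (sum-cong-≗ {m} (λ i → ℤₚ.*-distribʳ-+ (M i j) (a i) (b i)))
            (∑-distrib-+ (λ i → a i ℤ.* M i j) (λ i → b i ℤ.* M i j))

    combine-neg : ∀ a j → combine (λ i → ℤ.- a i) j ≡ ℤ.- combine a j
    combine-neg a j = begin
      combine (λ i → ℤ.- a i) j                ≡⟨ sum-cong-≗ {m} (λ i → eq (a i) (M i j)) ⟩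
      sumℤ (λ i → ℤ.-1ℤ ℤ.* (a i ℤ.* M i j))  ≡⟨ sym (*-distribˡ-sum ℤ.-1ℤ (λ i → a i ℤ.* M i j)) ⟩
      ℤ.-1ℤ ℤ.* combine a j                    ≡⟨ ℤₚ.-1*i≡-i (combine a j) ⟩
      ℤ.- combine a j                          ∎
      where
      eq : ∀ x y → ℤ.- x ℤ.* y ≡ ℤ.-1ℤ ℤ.* (x ℤ.* y)
      eq = solve-∀

  InRowLattice : Pred (Vector ℤ t) 0ℓ
  InRowLattice x = ∃ λ (a : Vector ℤ m) → ∀ j → x j ≡ sumℤ (λ i → a i ℤ.* M i j)

  private
    lattice-resp : ∀ {x y} → (∀ j → x j ≡ y j) → InRowLattice y → InRowLattice x
    lattice-resp eq (a , p) = a , λ j → trans (eq j) (p j)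

    lattice-0 : InRowLattice (λ _ → 0ℤ)
    lattice-0 = (λ _ → 0ℤ) , λ j → sym (combine-0 j)

    lattice-+ : ∀ {x y} → InRowLattice x → InRowLattice y →
                InRowLattice (λ j → x j ℤ.+ y j)
    lattice-+ (a , p) (b , q) =
      (λ i → a i ℤ.+ b i) , λ j → trans (cong₂ ℤ._+_ (p j) (q j)) (sym (combine-+ a b j))

    lattice-neg : ∀ {x} → InRowLattice x → InRowLattice (λ j → ℤ.- x j)
    lattice-neg (a , p) =
      (λ i → ℤ.- a i) , λ j → trans (cong ℤ.-_ (p j)) (sym (combine-neg a j))

    _≈_ : Rel (Vector ℤ t) 0ℓ
    x ≈ y = InRowLattice (λ j → x j ℤ.- y j)

    pointwise : ∀ {x y} → (∀ j → x j ≡ y j) → x ≈ y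
    pointwise eq = lattice-resp (λ j → ℤₚ.i≡j⇒i-j≡0 (eq j)) lattice-0

    neg-sub : ∀ x y → y ℤ.- x ≡ ℤ.- (x ℤ.- y)
    neg-sub = solve-∀

    sub-trans : ∀ x y z → x ℤ.- z ≡ (x ℤ.- y) ℤ.+ (y ℤ.- z)
    sub-trans = solve-∀

    sub-cong : ∀ x y u v →
               (x ℤ.+ u) ℤ.- (y ℤ.+ v) ≡ (x ℤ.- y) ℤ.+ (u ℤ.- v)
    sub-cong = solve-∀

    neg-cong : ∀ x y → (ℤ.- x) ℤ.- (ℤ.- y) ≡ ℤ.- (x ℤ.- y)
    neg-cong = solve-∀

  rowLatticeQuotient : AbelianGroup 0ℓ 0ℓ
  rowLatticeQuotient = record
    { Carrier = Vector ℤ t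
    ; _≈_     = _≈_
    ; _∙_     = λ x y j → x j ℤ.+ y j
    ; ε       = λ _ → 0ℤ
    ; _⁻¹     = λ x j → ℤ.- x j
    ; isAbelianGroup = record
      { isGroup = record
        { isMonoid = record
          { isSemigroup = record
            { isMagma = record
              { isEquivalence = record
                { refl  = λ {x} → pointwise {x} (λ _ → refl)
                ; sym   = λ {x} {y} p →
                    lattice-resp (λ j → neg-sub (x j) (y j)) (lattice-neg p)
                ; trans = λ {x} {y} {z} p q →
                    lattice-resp (λ j → sub-trans (x j) (y j) (z j)) (lattice-+ p q)
                }
              ; ∙-cong = λ {x} {y} {u} {v} p q →
                  lattice-resp (λ j → sub-cong (x j) (y j) (u j) (v j)) (lattice-+ p q)
              }
            ; assoc = λ x y z → pointwise (λ j → ℤₚ.+-assoc (x j) (y j) (z j))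
            }
          ; identity = (λ x → pointwise (λ j → ℤₚ.+-identityˡ (x j)))
                     , (λ x → pointwise (λ j → ℤₚ.+-identityʳ (x j)))
          }
        ; inverse = (λ x → pointwise (λ j → ℤₚ.+-inverseˡ (x j)))
                  , (λ x → pointwise (λ j → ℤₚ.+-inverseʳ (x j)))
        ; ⁻¹-cong = λ {x} {y} p →
            lattice-resp (λ j → neg-cong (x j) (y j)) (lattice-neg p)
        }
      ; comm = λ x y → pointwise (λ j → ℤₚ.+-comm (x j) (y j))
      }
    }

------------------------------------------------------------------------
-- Cayley graphs of abelian groups

module Cayley (Γ : AbelianGroup 0ℓ 0ℓ) where
  open AbelianGroup Γ

  CayleyAdjacent : Pred Carrier 0ℓ → Rel Carrier 0ℓ
  CayleyAdjacent S h h′ = ∃ λ s → S s × h′ ≈ h ∙ s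

  CayleyDistance : Pred Carrier 0ℓ → Carrier → Carrier → ℕ → Set
  CayleyDistance S = IsDistance _≈_ (CayleyAdjacent S)

  NonzeroSigned : ∀ {t} → Vector Carrier t → Pred Carrier 0ℓ
  NonzeroSigned g s = ¬ s ≈ ε × ∃ λ j → s ≈ g j ⊎ s ≈ g j ⁻¹

------------------------------------------------------------------------
-- Oriented partitions

-- class lists the parts F_j (nonempty, hence surjective); forward e is the
-- chosen direction of e, as the sign of a dart.

record OrientedPartition (G : Graph) (t : ℕ) : Set where
  open Graph G
  field
    class            : Edge → Fin t
    class-surjective : StrictlySurjective _≡_ class
    forward          : Edge → Sign

  -- + exactly when the dart runs in the forward direction of its edge.
  direction : Dart → Sign
  direction (e , s) = s Sign.* forward e

  crossings : List Dart → Vector ℤ t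
  crossings ds j = List.foldr ℤ._+_ 0ℤ (List.map crossing ds)
    where
    crossing : Dart → ℤ
    crossing d = if does (class (edge d) ≟ᶠ j) then direction d ◃ 1 else 0ℤ

  cycleClassMatrix : CycleBasis → Matrix cycleRank t
  cycleClassMatrix B i = crossings (darts (Cycle.walk (CycleBasis.cycle B i)))

module Universal {G : Graph} {t : ℕ} (F : OrientedPartition G t)
                 (B : Graph.CycleBasis G) where
  open Graph G
  open OrientedPartition F

  A : Matrix cycleRank t
  A = cycleClassMatrix B

  Γuniv : AbelianGroup 0ℓ 0ℓ
  Γuniv = rowLatticeQuotient A

  open AbelianGroup Γuniv using (Carrier; _∙_; ε; _⁻¹)

  g : Vector Carrier t
  g = identity

  signed : Sign → Carrier → Carrier
  signed Sign.+ x = x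
  signed Sign.- x = x ⁻¹

  module Labeling {r : Vertex} (P : ∀ v → Path r v) where

    φ : Vertex → Carrier
    φ v = List.foldr _∙_ ε
            (List.map (λ d → signed (direction d) (g (class (edge d))))
                      (darts (Path.walk (P v))))

    -- Quotients of Γuniv are again quotients of ℤᵗ, so that the labels and
    -- the generators in them are given by the same representatives.
    IsometricIn : ∀ {m} → Matrix m t → Set
    IsometricIn M = ∀ u v k → GraphDistance u v k →
                    CayleyDistance (NonzeroSigned g) (φ u) (φ v) k
      where open Cayley (rowLatticeQuotient M)

    -- Not automatic: on a path with two edges in one class, directed towards
    -- the middle vertex, φ takes the same value at both ends.
    UniversalIsometric : Set
    UniversalIsometric = IsometricIn A

    module Fold (snf : SmithNormalForm (A ᵀ)) where
      open SmithNormalForm snf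

      -- L is given by generators, the rows of a matrix.
      FoldIsometric : ∀ {l} → Matrix l free → Set
      FoldIsometric L = IsometricIn (A ++ pullback L)

      -- N₁ℤ × ⋯ × N_fℤ
      diagonalLattice : Vector ℕ free → Matrix free free
      diagonalLattice N = diagonal (λ i → + N i)

      labels : Fin free → List ℤ
      labels i = List.tabulate (λ v → freeCoordinate i (φ v))

      open Extrema ℤₚ.≤-totalOrder using (max; min)

      -- The root supplies the default value of the nonempty max and min.
      R : Fin free → ℤ
      R i = max (freeCoordinate i (φ r)) (labels i) ℤ.-
            min (freeCoordinate i (φ r)) (labels i)

      γ : Fin free → ℕ
      γ i = ExtremaNat.max 0 (List.tabulate (λ j → ∣ freeCoordinate i (g j) ∣))

{-# OPTIONS --safe #-}

-- Distances in a Cayley graph are minimal lengths of signed sums of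
-- generators.  If a signed sum of l ≤ diam(G) generators joins φ u to φ v in
-- the fold, then φ v - φ u minus that sum has i-th free coordinate at most
-- R_i + diam(G) γ_i < N_i in absolute value, and it is a multiple of N_i,
-- hence zero; so the same sum joins φ u to φ v in the universal group.  Sums
-- longer than diam(G) are longer than any distance of G.

module Submission where

open import Algebra.Bundles using (AbelianGroup)
open import Algebra.Core using (Op₁; Op₂)
import Algebra.Properties.Semiring.Sum as SemiringSum
open import Data.Fin.Base using (Fin; zero; suc; toℕ; _↑ˡ_; _↑ʳ_)
open import Data.Fin.Properties using (↑ʳ-injective; toℕ-cast; toℕ-injective)
  renaming (_≟_ to _≟ᶠ_)
open import Data.Integer.Base
  using (ℤ; +_; 0ℤ; -1ℤ; ∣_∣; _+_; _-_; _≤_; _>_; +≤+)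
  renaming (_*_ to _*ℤ_; -_ to -ℤ_)
import Data.Integer.Properties as ℤₚ
open import Data.Integer.Tactic.RingSolver using (solve-∀)
open import Data.List.Base using (List; []; _∷_; foldr; length; tabulate)
import Data.List.Extrema as Extrema
import Data.List.Extrema.Nat as ExtremaNat
import Data.List.Relation.Unary.All.Properties as All
open import Data.Nat.Base using (ℕ; NonZero; _*_)
import Data.Nat.Base as ℕ
import Data.Nat.Properties as ℕₚ
open import Data.Product.Base using (∃; _×_; _,_; proj₁)
open import Data.Sign.Base as Sign using (Sign)
open import Data.Sum.Base using (_⊎_; inj₁; inj₂)
open import Data.Vec.Functional using (Vector; _++_)
open import Data.Vec.Functional.Properties using (lookup-++ˡ; lookup-++ʳ)
open import Function.Base using (_∘_)
open import Function.Definitions using (Injective)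
open import Level using (0ℓ)
open import Relation.Binary.PropositionalEquality
  using (_≡_; refl; sym; trans; cong; cong₂; subst; module ≡-Reasoning)
import Relation.Binary.Reasoning.Setoid as SetoidReasoning
open import Relation.Nullary using (¬_; yes; no; contradiction)
open import Relation.Nullary.Decidable using (decidable-stable; ¬¬-excluded-middle)
open import Defs

open SemiringSum ℤₚ.+-*-semiring
  using (sum-cong-≗; ∑-distrib-+; ∑-comm; *-distribˡ-sum; sum-replicate-zero)

-- Cayley distance as the minimal length of a signed sum

-- Only the raw operations are parameters, so that the sums in two quotients
-- of ℤᵗ are definitionally the same vectors.
module SignedSum {C : Set} (_∙_ : Op₂ C) (ε : C) (_⁻¹ : Op₁ C)
                 {t} (g : Vector C t) where

  term : Sign × Fin t → C
  term (Sign.+ , j) = g j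
  term (Sign.- , j) = g j ⁻¹

  total : List (Sign × Fin t) → C
  total = foldr (λ d x → term d ∙ x) ε

module CayleySum (Γ : AbelianGroup 0ℓ 0ℓ) {t}
                 (g : Vector (AbelianGroup.Carrier Γ) t) where
  open AbelianGroup Γ renaming (refl to ≈-refl; sym to ≈-sym; trans to ≈-trans)
  open Cayley Γ
  open SignedSum _∙_ ε _⁻¹ g
  open SetoidReasoning setoid hiding (stop)

  Joins : Carrier → Carrier → List (Sign × Fin t) → Set
  Joins x y ds = y ≈ x ∙ total ds

  -- Vanishing terms are allowed, unlike in walks. A generator that is nonzero in one quotient may
  -- vanish in a further one, so signed sums pass between quotients where walks need not.
  IsMinimalLength : Carrier → Carrier → ℕ → Set
  IsMinimalLength x y k =
    (∃ λ ds → length ds ≡ k × Joins x y ds) ×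
    (∀ ds → Joins x y ds → k ℕ.≤ length ds)

  CayleyWalk : ℕ → Carrier → Carrier → Set
  CayleyWalk = Walk _≈_ (CayleyAdjacent (NonzeroSigned g))

  joins-∷⁺ : ∀ d ds {x y} → Joins (x ∙ term d) y ds → Joins x y (d ∷ ds)
  joins-∷⁺ d ds {x} p = ≈-trans p (assoc x (term d) (total ds))

  joins-∷⁻ : ∀ d ds {x y} → Joins x y (d ∷ ds) → Joins (x ∙ term d) y ds
  joins-∷⁻ d ds {x} p = ≈-trans p (≈-sym (assoc x (term d) (total ds)))

  joins-drop : ∀ d ds {x y} → term d ≈ ε → Joins x y (d ∷ ds) → Joins x y ds
  joins-drop d ds {x} {y} d≈ε p = begin
    y                        ≈⟨ p ⟩
    x ∙ (term d ∙ total ds)  ≈⟨ ∙-congˡ (∙-congʳ d≈ε) ⟩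
    x ∙ (ε ∙ total ds)       ≈⟨ ∙-congˡ (identityˡ _) ⟩
    x ∙ total ds             ∎

  term-signed : ∀ d → ∃ λ j → term d ≈ g j ⊎ term d ≈ g j ⁻¹
  term-signed (Sign.+ , j) = j , inj₁ ≈-refl
  term-signed (Sign.- , j) = j , inj₂ ≈-refl

  signed-term : ∀ {s} → NonzeroSigned g s → ∃ λ d → s ≈ term d
  signed-term (_ , j , inj₁ p) = (Sign.+ , j) , p
  signed-term (_ , j , inj₂ p) = (Sign.- , j) , p

  step-term : ∀ d {k x y} → ¬ term d ≈ ε → CayleyWalk k (x ∙ term d) y →
              CayleyWalk (ℕ.suc k) x y
  step-term d d≉ε w = step (term d , (d≉ε , term-signed d) , ≈-refl) w

  walk⇒joins : ∀ {k x y} → CayleyWalk k x y →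
               ∃ λ ds → length ds ≡ k × Joins x y ds
  walk⇒joins {x = x} {y} (stop p) = [] , refl , (begin
    y      ≈⟨ p ⟨
    x      ≈⟨ identityʳ x ⟨
    x ∙ ε  ∎)
  walk⇒joins {x = x} {y} (step {w = w} (s , Ss , q) walk)
    with signed-term Ss | walk⇒joins walk
  ... | d , s≈d | ds , eq , p = d ∷ ds , cong ℕ.suc eq , joins-∷⁺ d ds (begin
    y                        ≈⟨ p ⟩
    w ∙ total ds             ≈⟨ ∙-congʳ (≈-trans q (∙-congˡ s≈d)) ⟩
    (x ∙ term d) ∙ total ds  ∎)

  joins-[] : ∀ {x y} → Joins x y [] → x ≈ y
  joins-[] {x} p = ≈-sym (≈-trans p (identityʳ x))

  -- Dropping the vanishing terms leaves a walk, possibly shorter than the sum. Vanishing in the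
  -- quotient is not decided here, so each case split, and hence the walk, is available only under
  -- double negation.
  joins⇒¬¬shorterWalk : ∀ ds {x y} → Joins x y ds →
    ¬ ¬ (∃ λ k → k ℕ.≤ length ds × CayleyWalk k x y)
  joins⇒¬¬shorterWalk [] p ¬w = ¬w (0 , ℕ.z≤n , stop (joins-[] p))
  joins⇒¬¬shorterWalk (d ∷ ds) {x} {y} p ¬w = ¬¬-excluded-middle λ
    { (yes d≈ε) → joins⇒¬¬shorterWalk ds (joins-drop d ds d≈ε p)
        λ (k , k≤ , w) → ¬w (k , ℕₚ.m≤n⇒m≤1+n k≤ , w)
    ; (no d≉ε) → joins⇒¬¬shorterWalk ds (joins-∷⁻ d ds p)
        λ (k , k≤ , w) → ¬w (ℕ.suc k , ℕ.s≤s k≤ , step-term d d≉ε w)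
    }

  -- A vanishing summand could be dropped, contradicting minimality.
  minimal⇒walk : ∀ ds {x y} → Joins x y ds →
    (∀ es → Joins x y es → length ds ℕ.≤ length es) →
    CayleyWalk (length ds) x y
  minimal⇒walk [] p _ = stop (joins-[] p)
  minimal⇒walk (d ∷ ds) p min = step-term d
    (λ d≈ε → ℕₚ.1+n≰n (min ds (joins-drop d ds d≈ε p)))
    (minimal⇒walk ds (joins-∷⁻ d ds p)
      (λ es q → ℕ.s≤s⁻¹ (min (d ∷ es) (joins-∷⁺ d es q))))

  distance⇒minimalLength : ∀ {x y k} → CayleyDistance (NonzeroSigned g) x y k →
                           IsMinimalLength x y k
  distance⇒minimalLength {k = k} (w , min) = walk⇒joins w , λ ds p →
    -- The goal is a decidable inequality of naturals, so the double negation on the walk can be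
    -- removed.
    decidable-stable (k ℕₚ.≤? length ds) λ k≰ → joins⇒¬¬shorterWalk ds p
      λ (l , l≤ , w′) → k≰ (ℕₚ.≤-trans (min l w′) l≤)

  minimalLength⇒distance : ∀ {x y k} → IsMinimalLength x y k →
                           CayleyDistance (NonzeroSigned g) x y k
  minimalLength⇒distance ((ds , refl , p) , min) =
    minimal⇒walk ds p min , λ l w →
      let es , eq , q = walk⇒joins w in subst (length ds ℕ.≤_) eq (min es q)

-- Integer linear algebra

dot : ∀ {n} → Vector ℤ n → Vector ℤ n → ℤ
dot u x = sumℤ (λ j → u j *ℤ x j)

dot-zeroˡ : ∀ {n} {u : Vector ℤ n} x → (∀ j → u j ≡ 0ℤ) → dot u x ≡ 0ℤ
dot-zeroˡ {n} x u≡0 = trans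
  (sum-cong-≗ {n} (λ j → trans (cong (_*ℤ x j) (u≡0 j)) (ℤₚ.*-zeroˡ (x j))))
  (sum-replicate-zero n)

dot-comm : ∀ {n} (u x : Vector ℤ n) → dot u x ≡ dot x u
dot-comm u x = sum-cong-≗ (λ j → ℤₚ.*-comm (u j) (x j))

dot-cong : ∀ {n} (u : Vector ℤ n) {x y} → (∀ j → x j ≡ y j) → dot u x ≡ dot u y
dot-cong u x≡y = sum-cong-≗ (λ j → cong (u j *ℤ_) (x≡y j))

dot-zeroʳ : ∀ {n} u {x : Vector ℤ n} → (∀ j → x j ≡ 0ℤ) → dot u x ≡ 0ℤ
dot-zeroʳ u {x} x≡0 = trans (dot-comm u x) (dot-zeroˡ u x≡0)

dot-+ : ∀ {n} (u x y : Vector ℤ n) → dot u (λ j → x j + y j) ≡ dot u x + dot u y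
dot-+ u x y = trans
  (sum-cong-≗ (λ j → ℤₚ.*-distribˡ-+ (u j) (x j) (y j)))
  (∑-distrib-+ (λ j → u j *ℤ x j) (λ j → u j *ℤ y j))

-- Exchange of two finite sums. It serves both as linearity of a free coordinate on combinations of
-- rows and as associativity of matrix products.
dot-combination : ∀ {m n} (u : Vector ℤ n) (a : Vector ℤ m) (M : Matrix m n) →
  dot u (λ j → dot a (λ i → M i j)) ≡ dot a (λ i → dot u (M i))
dot-combination {m} {n} u a M = begin
  sumℤ (λ j → u j *ℤ sumℤ (λ i → a i *ℤ M i j))   ≡⟨ sum-cong-≗ (λ j → *-distribˡ-sum (u j) (λ i → a i *ℤ M i j)) ⟩
  sumℤ (λ j → sumℤ (λ i → u j *ℤ (a i *ℤ M i j))) ≡⟨ ∑-comm (λ j i → u j *ℤ (a i *ℤ M i j)) ⟩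
  sumℤ (λ i → sumℤ (λ j → u j *ℤ (a i *ℤ M i j))) ≡⟨ sum-cong-≗ (λ i → sum-cong-≗ (λ j → swap (u j) (a i) (M i j))) ⟩
  sumℤ (λ i → sumℤ (λ j → a i *ℤ (u j *ℤ M i j))) ≡⟨ sum-cong-≗ (λ i → *-distribˡ-sum (a i) (λ j → u j *ℤ M i j)) ⟨
  sumℤ (λ i → a i *ℤ sumℤ (λ j → u j *ℤ M i j))   ∎
  where
  open ≡-Reasoning
  swap : ∀ x y z → x *ℤ (y *ℤ z) ≡ y *ℤ (x *ℤ z)
  swap = solve-∀

dot-neg : ∀ {n} (u x : Vector ℤ n) → dot u (λ j → -ℤ x j) ≡ -ℤ dot u x
dot-neg u x = begin
  dot u (λ j → -ℤ x j)              ≡⟨ sum-cong-≗ (λ j → neg (u j) (x j)) ⟩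
  sumℤ (λ j → -1ℤ *ℤ (u j *ℤ x j))  ≡⟨ *-distribˡ-sum -1ℤ (λ j → u j *ℤ x j) ⟨
  -1ℤ *ℤ dot u x                    ≡⟨ ℤₚ.-1*i≡-i (dot u x) ⟩
  -ℤ dot u x                        ∎
  where
  open ≡-Reasoning
  neg : ∀ x y → x *ℤ (-ℤ y) ≡ -1ℤ *ℤ (x *ℤ y)
  neg = solve-∀

sum-split : ∀ m {n} (x : Vector ℤ (m ℕ.+ n)) →
  sumℤ x ≡ sumℤ (λ i → x (i ↑ˡ n)) + sumℤ (λ i → x (m ↑ʳ i))
sum-split ℕ.zero    x = sym (ℤₚ.+-identityˡ (sumℤ x))
sum-split (ℕ.suc m) x = trans
  (cong (_+_ (x zero)) (sum-split m (x ∘ suc)))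
  (sym (ℤₚ.+-assoc (x zero) _ _))

dot-diagonal : ∀ {p} (b d : Vector ℤ p) i → dot b (λ k → diagonal d k i) ≡ b i *ℤ d i
dot-diagonal b d zero = trans
  (cong (_+_ (b zero *ℤ d zero)) (dot-zeroʳ (b ∘ suc) (λ _ → refl)))
  (ℤₚ.+-identityʳ _)
-- The entry `diagonal d (suc k) (suc i)` reduces to `diagonal (d ∘ suc) k i`, so the induction
-- hypothesis applies without rewriting.
dot-diagonal b d (suc i) = trans
  (cong₂ _+_ (ℤₚ.*-zeroʳ (b zero)) (dot-diagonal (b ∘ suc) (d ∘ suc) i))
  (ℤₚ.+-identityˡ _)

dot-identity : ∀ {p} (b : Vector ℤ p) i → dot b (λ k → identity k i) ≡ b i
dot-identity b i = trans (dot-diagonal b _ i) (ℤₚ.*-identityʳ (b i))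

-- With `freeRow` for `f`, this restricts the product of `U` and `U⁻¹` to the free rows. The indices
-- are swapped on the right to match `dot-identity`.
identity-injection : ∀ {p q} {f : Fin p → Fin q} → Injective _≡_ _≡_ f →
                     ∀ i j → identity (f i) (f j) ≡ identity j i
identity-injection {f = f} inj i j with f i ≟ᶠ f j | j ≟ᶠ i
... | yes _ | yes _  = refl
... | no  _ | no  _  = refl
... | yes p | no j≢i = contradiction (sym (inj p)) j≢i
... | no ¬p | yes q  = contradiction (cong f (sym q)) ¬p

-- Row lattices of stacked matrices, and small multiples

inRowLattice-++⁺ : ∀ {m n t} (M : Matrix m t) (L : Matrix n t) {x} →
                   InRowLattice M x → InRowLattice (M ++ L) x
inRowLattice-++⁺ {m} {n} M L {x} (a , p) = a ++ 0ⁿ , λ j → sym (begin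
  dot (a ++ 0ⁿ) (λ i → (M ++ L) i j)
    ≡⟨ sum-split m _ ⟩
  dot (λ i → (a ++ 0ⁿ) (i ↑ˡ n)) (λ i → (M ++ L) (i ↑ˡ n) j) +
  dot (λ i → (a ++ 0ⁿ) (m ↑ʳ i)) (λ i → (M ++ L) (m ↑ʳ i) j)
    ≡⟨ cong₂ _+_
         (sum-cong-≗ (λ i → cong₂ _*ℤ_ (lookup-++ˡ a 0ⁿ i)
                                       (cong (λ row → row j) (lookup-++ˡ M L i))))
         (dot-zeroˡ _ (lookup-++ʳ a 0ⁿ)) ⟩
  dot a (λ i → M i j) + 0ℤ
    ≡⟨ ℤₚ.+-identityʳ _ ⟩
  dot a (λ i → M i j)
    ≡⟨ p j ⟨
  x j ∎)
  where
  open ≡-Reasoning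
  0ⁿ : Vector ℤ n
  0ⁿ _ = 0ℤ

inRowLattice-++⁻ : ∀ {m n t} (M : Matrix m t) (L : Matrix n t) {x} →
  InRowLattice (M ++ L) x →
  ∃ λ a → ∃ λ b → ∀ j → x j ≡ dot a (λ i → M i j) + dot b (λ i → L i j)
inRowLattice-++⁻ {m} {n} M L (c , p) =
  (λ i → c (i ↑ˡ n)) , (λ i → c (m ↑ʳ i)) , λ j →
  trans (p j) (trans (sum-split m _) (cong₂ _+_
    (dot-cong (λ i → c (i ↑ˡ n)) (λ i → cong (λ row → row j) (lookup-++ˡ M L i)))
    (dot-cong (λ i → c (m ↑ʳ i)) (λ i → cong (λ row → row j) (lookup-++ʳ M L i)))))

-- Cancelling `n` leaves an absolute value below 1. Strictness is essential: `b = 1` attains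
-- equality.
∣multiple∣<⇒0 : ∀ b n → ∣ b *ℤ + n ∣ ℕ.< n → b ≡ 0ℤ
∣multiple∣<⇒0 b n lt = ℤₚ.∣i∣≡0⇒i≡0 (ℕₚ.n<1⇒n≡0
  (ℕₚ.*-cancelʳ-< n ∣ b ∣ 1 (begin-strict
    ∣ b ∣ * n       ≡⟨ ℤₚ.abs-* b (+ n) ⟨
    ∣ b *ℤ + n ∣    <⟨ lt ⟩
    n               ≡⟨ ℕₚ.*-identityˡ n ⟨
    1 * n           ∎)))
  where open ℕₚ.≤-Reasoning

-- Free coordinates from the Smith normal form

module _ {m t} (A : Matrix m t) (snf : SmithNormalForm (A ᵀ)) where
  open SmithNormalForm snf
  open ≡-Reasoning

  freeRow-injective : Injective _≡_ _≡_ freeRow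
  freeRow-injective {i} {j} eq = ↑ʳ-injective rank i j (toℕ-injective (begin
    toℕ (rank ↑ʳ i)  ≡⟨ toℕ-cast rank+free (rank ↑ʳ i) ⟨
    toℕ (freeRow i)  ≡⟨ cong toℕ eq ⟩
    toℕ (freeRow j)  ≡⟨ toℕ-cast rank+free (rank ↑ʳ j) ⟩
    toℕ (rank ↑ʳ j)  ∎))

  -- The free rows of `U ⊗ A ᵀ ⊗ V` vanish, and multiplying by `V⁻¹` on the right carries this over
  -- to `U ⊗ A ᵀ`. Thus free coordinates are well defined on the universal group.
  freeCoordinate-row : ∀ i k → freeCoordinate i (A k) ≡ 0ℤ
  freeCoordinate-row i k = begin
    W k                                              ≡⟨ dot-identity W k ⟨
    dot W (λ j → identity j k)                       ≡⟨ dot-cong W (λ j → proj₁ V-inverse j k) ⟨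
    dot W (λ j → dot (V j) (λ l → V⁻¹ l k))          ≡⟨ dot-cong W (λ j → dot-comm (V j) _) ⟩
    dot W (λ j → dot (λ l → V⁻¹ l k) (V j))          ≡⟨ dot-combination W (λ l → V⁻¹ l k) (V ᵀ) ⟩
    dot (λ l → V⁻¹ l k) ((U ⊗ A ᵀ ⊗ V) (freeRow i))  ≡⟨ dot-zeroʳ (λ l → V⁻¹ l k) (zero-rows i) ⟩
    0ℤ                                               ∎
    where
    W : Vector ℤ m
    W = (U ⊗ A ᵀ) (freeRow i)

  -- `pullback` embeds a row through the free columns of `U⁻¹`, and `U` undoes this: the free block
  -- of `U ⊗ U⁻¹` is again an identity matrix.
  freeCoordinate-pullback : ∀ {l} (L : Matrix l free) i k →
                            freeCoordinate i (pullback L k) ≡ L k i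
  freeCoordinate-pullback L i k = begin
    dot (U (freeRow i)) (pullback L k)
      ≡⟨ dot-cong (U (freeRow i)) (λ j → dot-comm (λ i′ → U⁻¹ j (freeRow i′)) (L k)) ⟩
    dot (U (freeRow i)) (λ j → dot (L k) (λ i′ → U⁻¹ j (freeRow i′)))
      ≡⟨ dot-combination (U (freeRow i)) (L k) (λ i′ j → U⁻¹ j (freeRow i′)) ⟩
    dot (L k) (λ i′ → (U ⊗ U⁻¹) (freeRow i) (freeRow i′))
      ≡⟨ dot-cong (L k) (λ i′ → trans (proj₁ U-inverse _ _)
                                      (identity-injection freeRow-injective i i′)) ⟩
    dot (L k) (λ i′ → identity i′ i)
      ≡⟨ dot-identity (L k) i ⟩
    L k i ∎

  -- Split `x` into a combination `a` of rows of `A` and a combination `b` of folding rows. The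
  -- first part has zero free coordinates, so coordinate `i` of `x` is `b i` times `N i`, and
  -- smallness forces `b i` to be 0. The same `a` is then the witness.
  diagonalFold⇒rowLattice : (N : Vector ℕ free) {x : Vector ℤ t} →
    InRowLattice (A ++ pullback (diagonal (λ i → + N i))) x →
    (∀ i → ∣ freeCoordinate i x ∣ ℕ.< N i) →
    InRowLattice A x
  diagonalFold⇒rowLattice N {x} x∈ small
    with a , b , x≡ ← inRowLattice-++⁻ A (pullback (diagonal (λ i → + N i))) x∈
    = a , λ j → begin
    x j
      ≡⟨ x≡ j ⟩
    dot a (λ k → A k j) + dot b (λ k → pullback D k j)
      ≡⟨ cong (_+_ (dot a (λ k → A k j))) (dot-zeroˡ (λ k → pullback D k j) b≡0) ⟩
    dot a (λ k → A k j) + 0ℤ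
      ≡⟨ ℤₚ.+-identityʳ _ ⟩
    dot a (λ k → A k j) ∎
    where
    D : Matrix free free
    D = diagonal (λ i → + N i)

    coordinate : ∀ i → freeCoordinate i x ≡ b i *ℤ + N i
    coordinate i = begin
      dot u x
        ≡⟨ dot-cong u x≡ ⟩
      dot u (λ j → dot a (λ k → A k j) + dot b (λ k → pullback D k j))
        ≡⟨ dot-+ u _ _ ⟩
      dot u (λ j → dot a (λ k → A k j)) + dot u (λ j → dot b (λ k → pullback D k j))
        ≡⟨ cong₂ _+_ (dot-combination u a A) (dot-combination u b (pullback D)) ⟩
      dot a (λ k → freeCoordinate i (A k)) + dot b (λ k → freeCoordinate i (pullback D k))
        ≡⟨ cong₂ _+_ (dot-zeroʳ a (freeCoordinate-row i))
                     (dot-cong b (freeCoordinate-pullback D i)) ⟩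
      0ℤ + dot b (λ k → D k i)
        ≡⟨ ℤₚ.+-identityˡ _ ⟩
      dot b (λ k → D k i)
        ≡⟨ dot-diagonal b (λ k → + N k) i ⟩
      b i *ℤ + N i ∎
      where
      u : Vector ℤ t
      u = U (freeRow i)

    b≡0 : ∀ i → b i ≡ 0ℤ
    b≡0 i = ∣multiple∣<⇒0 (b i) (N i)
      (subst (λ z → ∣ z ∣ ℕ.< N i) (coordinate i) (small i))

-- Bounds on free coordinates of labels and signed sums

∣-∣≤range : ∀ {lo hi} x y → lo ≤ x → x ≤ hi → lo ≤ y → y ≤ hi →
            + ∣ x - y ∣ ≤ hi - lo
∣-∣≤range x y lo≤x x≤hi lo≤y y≤hi with ℤₚ.≤-total x y
... | inj₁ x≤y rewrite ℤₚ.∣-∣-≤ x≤y =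
  ℤₚ.+-mono-≤ y≤hi (ℤₚ.neg-mono-≤ lo≤x)
... | inj₂ y≤x rewrite ℤₚ.∣i-j∣≡∣j-i∣ x y | ℤₚ.∣-∣-≤ y≤x =
  ℤₚ.+-mono-≤ x≤hi (ℤₚ.neg-mono-≤ lo≤y)

module _ {G : Graph} {t : ℕ} (F : OrientedPartition G t) (B : Graph.CycleBasis G)
  where
  open Universal F B

  module _ (snf : SmithNormalForm (A ᵀ)) {r : Graph.Vertex G}
           (P : ∀ v → Graph.Path G r v) where
    open SmithNormalForm snf
    open Labeling P
    open Fold snf
    open AbelianGroup Γuniv using (_∙_; ε; _⁻¹)
    open SignedSum _∙_ ε _⁻¹ g

    ∣label-label∣≤R : ∀ i u v →
      + ∣ freeCoordinate i (φ v) - freeCoordinate i (φ u) ∣ ≤ R i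
    ∣label-label∣≤R i u v = ∣-∣≤range _ _ (min≤ v) (≤max v) (min≤ u) (≤max u)
      where
      open Extrema ℤₚ.≤-totalOrder
      min≤ : ∀ w → min (freeCoordinate i (φ r)) (labels i) ≤ freeCoordinate i (φ w)
      min≤ = All.tabulate⁻ (min≤xs (freeCoordinate i (φ r)) (labels i))
      ≤max : ∀ w → freeCoordinate i (φ w) ≤ max (freeCoordinate i (φ r)) (labels i)
      ≤max = All.tabulate⁻ (xs≤max (freeCoordinate i (φ r)) (labels i))

    ∣term∣≤γ : ∀ i d → ∣ freeCoordinate i (term d) ∣ ℕ.≤ γ i
    ∣term∣≤γ i (Sign.+ , j) = All.tabulate⁻ (ExtremaNat.xs≤max 0
      (tabulate (λ j → ∣ freeCoordinate i (g j) ∣))) j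
    ∣term∣≤γ i (Sign.- , j) = begin
      ∣ freeCoordinate i (term (Sign.- , j)) ∣  ≡⟨ cong ∣_∣ (dot-neg (U (freeRow i)) (g j)) ⟩
      ∣ -ℤ freeCoordinate i (g j) ∣             ≡⟨ ℤₚ.∣-i∣≡∣i∣ (freeCoordinate i (g j)) ⟩
      ∣ freeCoordinate i (g j) ∣                ≤⟨ ∣term∣≤γ i (Sign.+ , j) ⟩
      γ i                                       ∎
      where open ℕₚ.≤-Reasoning

    ∣total∣≤length*γ : ∀ i ds → ∣ freeCoordinate i (total ds) ∣ ℕ.≤ length ds * γ i
    ∣total∣≤length*γ i [] =
      ℕₚ.≤-reflexive (cong ∣_∣ (dot-zeroʳ (U (freeRow i)) (λ _ → refl)))
    ∣total∣≤length*γ i (d ∷ ds) = begin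
      ∣ freeCoordinate i (total (d ∷ ds)) ∣
        ≡⟨ cong ∣_∣ (dot-+ (U (freeRow i)) (term d) (total ds)) ⟩
      ∣ freeCoordinate i (term d) + freeCoordinate i (total ds) ∣
        ≤⟨ ℤₚ.∣i+j∣≤∣i∣+∣j∣ (freeCoordinate i (term d)) (freeCoordinate i (total ds)) ⟩
      ∣ freeCoordinate i (term d) ∣ ℕ.+ ∣ freeCoordinate i (total ds) ∣
        ≤⟨ ℕₚ.+-mono-≤ (∣term∣≤γ i d) (∣total∣≤length*γ i ds) ⟩
      γ i ℕ.+ length ds * γ i ∎
      where open ℕₚ.≤-Reasoning

    -- By linearity the coordinate splits into a difference of two labels, bounded by the range, and
    -- that of the signed sum, bounded by `γ i` per term. The bound uses the length of the sum; the
    -- diameter enters only when the sum is compared with a distance.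
    ∣difference∣≤ : ∀ i u v ds →
      + ∣ freeCoordinate i (λ j → φ v j - (φ u ∙ total ds) j) ∣ ≤ R i + + (length ds * γ i)
    ∣difference∣≤ i u v ds = begin
      + ∣ fc (λ j → φ v j - (φ u j + total ds j)) ∣
        ≡⟨ cong (+_ ∘ ∣_∣) linear ⟩
      + ∣ (fc (φ v) - fc (φ u)) - fc (total ds) ∣
        ≤⟨ +≤+ (ℤₚ.∣i-j∣≤∣i∣+∣j∣ (fc (φ v) - fc (φ u)) (fc (total ds))) ⟩
      + ∣ fc (φ v) - fc (φ u) ∣ + + ∣ fc (total ds) ∣
        ≤⟨ ℤₚ.+-mono-≤ (∣label-label∣≤R i u v) (+≤+ (∣total∣≤length*γ i ds)) ⟩
      R i + + (length ds * γ i) ∎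
      where
      open ℤₚ.≤-Reasoning
      fc : Vector ℤ t → ℤ
      fc = freeCoordinate i
      w : Vector ℤ t
      w = U (freeRow i)
      regroup : ∀ x y z → x + -ℤ (y + z) ≡ (x - y) - z
      regroup = solve-∀
      linear : fc (λ j → φ v j - (φ u j + total ds j)) ≡ (fc (φ v) - fc (φ u)) - fc (total ds)
      linear = trans (dot-+ w (φ v) (λ j → -ℤ (φ u j + total ds j)))
        (trans (cong (_+_ (fc (φ v)))
          (trans (dot-neg w (λ j → φ u j + total ds j))
                 (cong -ℤ_ (dot-+ w (φ u) (total ds)))))
          (regroup (fc (φ v)) (fc (φ u)) (fc (total ds))))

    -- Transfer of minimal lengths from the universal group to the fold

    module _ (N : Vector ℕ free) where
      private
        M : Matrix (Graph.cycleRank G ℕ.+ free) t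
        M = A ++ pullback (diagonalLattice N)
        module 𝕌 = CayleySum Γuniv g
        module 𝔽 = CayleySum (rowLatticeQuotient M) g

      joins-universal⇒fold : ∀ u v ds → 𝕌.Joins (φ u) (φ v) ds → 𝔽.Joins (φ u) (φ v) ds
      joins-universal⇒fold u v ds = inRowLattice-++⁺ A (pullback (diagonalLattice N))

      -- Both relations assert lattice membership of the same vector, the difference of `φ v` and
      -- `φ u ∙ total ds`. Its free coordinates are too small for a nonzero folding part.
      joins-fold⇒universal : ∀ u v ds → (∀ i → + N i > R i + + (length ds * γ i)) →
                             𝔽.Joins (φ u) (φ v) ds → 𝕌.Joins (φ u) (φ v) ds
      joins-fold⇒universal u v ds N> p = diagonalFold⇒rowLattice A snf N p
        λ i → ℤₚ.drop‿+<+ (ℤₚ.≤-<-trans (∣difference∣≤ i u v ds) (N> i))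

      diagonalFold-isometric : UniversalIsometric → ∀ diam →
        (∀ u v k → Graph.GraphDistance G u v k → k ℕ.≤ diam) →
        (∀ i → + N i > R i + + (diam * γ i)) →
        FoldIsometric (diagonalLattice N)
      diagonalFold-isometric isometric diam ≤diam N> u v k dist =
        𝔽.minimalLength⇒distance {φ u} {φ v}
          (transfer (𝕌.distance⇒minimalLength {φ u} {φ v} (isometric u v k dist)))
        where
        transfer : 𝕌.IsMinimalLength (φ u) (φ v) k → 𝔽.IsMinimalLength (φ u) (φ v) k
        transfer ((ds , eq , p) , minimal) =
          (ds , eq , joins-universal⇒fold u v ds p) , λ es q → case es q
          where
          case : ∀ es → 𝔽.Joins (φ u) (φ v) es → k ℕ.≤ length es
          -- The split is at `k`, not at `diam`. In the second case `length es ≤ k ≤ diam`, so `N>`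
          -- covers the sum `es`; it then joins the labels in the universal group too, and
          -- minimality there gives the bound.
          case es q with ℕₚ.≤-total k (length es)
          ... | inj₁ k≤ = k≤
          ... | inj₂ ≤k = minimal es (joins-fold⇒universal u v es
            (λ i → ℤₚ.≤-<-trans (ℤₚ.+-monoʳ-≤ (R i) (+≤+
              (ℕₚ.*-monoˡ-≤ (γ i) (ℕₚ.≤-trans ≤k (≤diam u v k dist))))) (N> i)) q)

theorem7 : (G : Graph) → let open Graph G in
    Connected →
    {t : ℕ} (F : OrientedPartition G t) (B : CycleBasis) →
    let open Universal F B in
    (snf : SmithNormalForm (A ᵀ)) → let open SmithNormalForm snf in
    {r : Vertex} (P : ∀ v → Path r v) →
    let open Labeling P
        open Fold snf in
    UniversalIsometric →
    (diam : ℕ) → IsDiameter diam →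
    (N : Vector ℕ free) → (∀ i → NonZero (N i)) →
    (∀ i → + N i > R i + + (diam * γ i)) →
    FoldIsometric (diagonalLattice N)
theorem7 G _ F B snf P isometric diam (_ , ≤diam) N _ N> =
  diagonalFold-isometric F B snf P N isometric diam ≤diam N>
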